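{- Let $\mathsf{CS}$ be a constant specification for $\mathsf{LP}$. Every full $\mathsf{LP}_{\mathsf{CS}}$ algebra is isomorphic to a full $\mathsf{LP}_{\mathsf{CS}}$ set algebra.
   Context: **Language.** Let $\mathsf{Const}$, $\mathsf{Var}$, $\mathsf{Prop}$ be the sets of proof constants, proof variables and propositional atoms. Terms ($\mathsf{Tm}$) and formulas ($\mathsf{Fm}$) are given by $s,t ::= c \mid x \mid s+t \mid s\cdot t \mid\, !t$ and $\varphi,\psi ::= p \mid \bot \mid \neg\varphi \mid \varphi\vee\psi \mid t:\varphi$, with $c\in\mathsf{Const}$, $x\in\mathsf{Var}$, $p\in\mathsf{Prop}$. Abbreviations: $\varphi\to\psi:=\neg\varphi\vee\psi$; $\wedge,\leftrightarrow$ as usual. **Constant specifications.** The axiom schemes of $\mathsf{LP}_\emptyset$ are: $\varphi\to(\varphi\vee\psi)$; $(\varphi\vee\psi)\to(\psi\vee\varphi)$; $(\varphi\vee\varphi)\to\varphi$; $(\varphi\to\psi)\to((\chi\vee\varphi)\to(\chi\vee\psi))$; $\bot\to\varphi$; $s:(\varphi\to\psi)\to(t:\varphi\to(s\cdot t):\psi)$; $(s:\varphi\vee t:\varphi)\to(s+t):\varphi$; $t:\varphi\to\varphi$; $t:\varphi\to\,!t:t:\varphi$. A constant specification $\mathsf{CS}$ for $\mathsf{LP}$ is a set of formulas $c:\varphi$ with $c\in\mathsf{Const}$ and $\varphi$ an axiom instance. **Boolean algebras** are written $(A,0,\ominus,\oplus)$ (least element, complement, join), with $1:=\ominus 0$,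 meet $a\otimes b:=\ominus(\ominus a\oplus\ominus b)$, $a\Rightarrow b:=\ominus a\oplus b$, and $a\le b$ iff $a\Rightarrow b=1$. **Pre $\mathsf{LP}_{\mathsf{CS}}$ algebra:** a tuple $\mathcal{A}=(A,0,\ominus,\oplus,\Box_t)_{t\in\mathsf{Tm}}$ where $(A,0,\ominus,\oplus)$ is a Boolean algebra and each $\Box_t:\mathsf{Fm}\to A$ is a function such that for all $\varphi,\psi\in\mathsf{Fm}$, $s,t\in\mathsf{Tm}$, $c\in\mathsf{Const}$: $\Box_s(\varphi\to\psi)\otimes\Box_t(\varphi)\le\Box_{s\cdot t}(\psi)$; $\Box_s(\varphi)\oplus\Box_t(\varphi)\le\Box_{s+t}(\varphi)$; $\Box_t(\varphi)\le\Box_{!t}(t:\varphi)$; $\Box_c(\varphi)=1$ whenever $c:\varphi\in\mathsf{CS}$. **Assignment.** A valuation $\theta:\mathsf{Prop}\to A$ is extended to $\tilde\theta:\mathsf{Fm}\to A$ by $\tilde\theta(p)=\theta(p)$, $\tilde\theta(\bot)=0$, $\tilde\theta(\neg\varphi)=\ominus\tilde\theta(\varphi)$, $\tilde\theta(\varphi\vee\psi)=\tilde\theta(\varphi)\oplus\tilde\theta(\psi)$, $\tilde\theta(t:\varphi)=\Box_t(\varphi)$. **Full $\mathsf{LP}_{\mathsf{CS}}$ algebra:** a pre $\mathsf{LP}_{\mathsf{CS}}$ algebra such that $\Box_t(\varphi)\le\tilde\theta(\varphi)$ for all $\varphi\in\mathsf{Fm}$, all $t\in\mathsf{Tm}$ and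 all valuations $\theta:\mathsf{Prop}\to A$. **Set algebras.** A set algebra is a subalgebra of a power set algebra $(\mathcal{P}(X),\emptyset,\setminus,\cup)$, where $\setminus$ is complement relative to $X$. A full $\mathsf{LP}_{\mathsf{CS}}$ set algebra is a full $\mathsf{LP}_{\mathsf{CS}}$ algebra whose underlying Boolean algebra is a set algebra. **Isomorphism.** An isomorphism of full $\mathsf{LP}_{\mathsf{CS}}$ algebras $\mathcal{A}\to\mathcal{B}$ is an isomorphism $f$ of the underlying Boolean algebras with $f(\Box_t^{\mathcal{A}}(\varphi))=\Box_t^{\mathcal{B}}(\varphi)$ for all $t\in\mathsf{Tm}$, $\varphi\in\mathsf{Fm}$. -}

module Defs where

open import Level using (Level; _⊔_; suc)
open import Axiom.ExcludedMiddle using (ExcludedMiddle)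
open import Algebra.Lattice.Bundles using (BooleanAlgebra)
import Algebra.Lattice.Properties.BooleanAlgebra as BooleanAlgebraProperties
open import Data.Empty.Polymorphic using (⊥-elim)
import Data.Empty as Empty
open import Data.Product using (Σ; ∃-syntax; _×_; _,_; proj₁; proj₂)
open import Data.Sum using (inj₁; inj₂)
open import Function.Definitions using (Congruent; Injective; Surjective)
open import Relation.Binary.Definitions using (_Respects_)
open import Relation.Binary.PropositionalEquality using (_≡_)
open import Relation.Nullary using (yes; no)
open import Relation.Unary using (Pred; _∈_; _≐_; ∁; _∪_; _∩_)
open import Relation.Unary.Algebra using (∪-∩-isDistributiveLattice)
open import Relation.Unary.Polymorphic using (∅; U)

record Language (c v p : Level) : Set (suc (c ⊔ v ⊔ p)) where
  field
    Const : Set c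
    Var   : Set v
    Atom  : Set p

module _ {c v p : Level} (L : Language c v p) where
  open Language L

  infixl 7 _·_
  infixl 6 _+_
  infix  8 !_

  data Tm : Set (c ⊔ v) where
    con : Const → Tm
    var : Var → Tm
    _+_ : Tm → Tm → Tm
    _·_ : Tm → Tm → Tm
    !_  : Tm → Tm

  infix  8 ¬ᶠ_
  infixr 8 _∶_
  infixr 6 _∨ᶠ_

  data Fm : Set (c ⊔ v ⊔ p) where
    atom : Atom → Fm
    ⊥ᶠ   : Fm
    ¬ᶠ_  : Fm → Fm
    _∨ᶠ_ : Fm → Fm → Fm
    _∶_  : Tm → Fm → Fm

module _ {c v p : Level} {L : Language c v p} where

  infixr 5 _⇒ᶠ_

  _⇒ᶠ_ : Fm L → Fm L → Fm L
  φ ⇒ᶠ ψ = (¬ᶠ φ) ∨ᶠ ψ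

  data Axiom : Fm L → Set (c ⊔ v ⊔ p) where
    ∨-intro   : ∀ φ ψ → Axiom (φ ⇒ᶠ (φ ∨ᶠ ψ))
    ∨-swap    : ∀ φ ψ → Axiom ((φ ∨ᶠ ψ) ⇒ᶠ (ψ ∨ᶠ φ))
    ∨-contr   : ∀ φ → Axiom ((φ ∨ᶠ φ) ⇒ᶠ φ)
    ∨-mono    : ∀ φ ψ χ → Axiom ((φ ⇒ᶠ ψ) ⇒ᶠ ((χ ∨ᶠ φ) ⇒ᶠ (χ ∨ᶠ ψ)))
    explosion : ∀ φ → Axiom (⊥ᶠ ⇒ᶠ φ)
    app       : ∀ s t φ ψ → Axiom ((s ∶ (φ ⇒ᶠ ψ)) ⇒ᶠ ((t ∶ φ) ⇒ᶠ ((s · t) ∶ ψ)))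
    sum       : ∀ s t φ → Axiom (((s ∶ φ) ∨ᶠ (t ∶ φ)) ⇒ᶠ ((s + t) ∶ φ))
    factivity : ∀ t φ → Axiom ((t ∶ φ) ⇒ᶠ φ)
    checker   : ∀ t φ → Axiom ((t ∶ φ) ⇒ᶠ ((! t) ∶ (t ∶ φ)))

record ConstantSpecification {c v p : Level} (L : Language c v p) (s : Level)
    : Set (c ⊔ v ⊔ p ⊔ suc s) where
  field
    formulas   : Pred (Fm L) s
    isConstant : ∀ {χ} → χ ∈ formulas →
                 ∃[ k ] ∃[ φ ] (χ ≡ (con k ∶ φ)) × Axiom φ

-- The standard library's Boolean algebras carry _∧_ and ⊤ as primitives; here
-- unit, meet, implication and order are the ones derived from ⊥, ¬_ and _∨_.
module Derived {a ℓ : Level} (B : BooleanAlgebra a ℓ) where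
  open BooleanAlgebra B using (Carrier; _≈_; ⊥; ¬_; _∨_)

  infixr 7 _⊗_
  infixr 5 _⇒_
  infix  4 _≤_

  𝟙 : Carrier
  𝟙 = ¬ ⊥

  _⊗_ : Carrier → Carrier → Carrier
  x ⊗ y = ¬ (¬ x ∨ ¬ y)

  _⇒_ : Carrier → Carrier → Carrier
  x ⇒ y = ¬ x ∨ y

  _≤_ : Carrier → Carrier → Set ℓ
  x ≤ y = (x ⇒ y) ≈ 𝟙

module _ {c v p s : Level} {L : Language c v p} (CS : ConstantSpecification L s)
         {a ℓ : Level} (B : BooleanAlgebra a ℓ)
         (□ : Tm L → Fm L → BooleanAlgebra.Carrier B) where
  open Language L
  open ConstantSpecification CS
  open BooleanAlgebra B using (Carrier; _≈_; ⊥; ¬_; _∨_)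
  open Derived B

  record IsPreLPAlgebra : Set (c ⊔ v ⊔ p ⊔ s ⊔ ℓ) where
    field
      □-app   : ∀ s t φ ψ → (□ s (φ ⇒ᶠ ψ) ⊗ □ t φ) ≤ □ (s · t) ψ
      □-sum   : ∀ s t φ → (□ s φ ∨ □ t φ) ≤ □ (s + t) φ
      □-check : ∀ t φ → □ t φ ≤ □ (! t) (t ∶ φ)
      □-const : ∀ k φ → (con k ∶ φ) ∈ formulas → □ (con k) φ ≈ 𝟙

  assign : (Atom → Carrier) → Fm L → Carrier
  assign θ (atom q) = θ q
  assign θ ⊥ᶠ       = ⊥
  assign θ (¬ᶠ φ)   = ¬ assign θ φ
  assign θ (φ ∨ᶠ ψ) = assign θ φ ∨ assign θ ψ
  assign θ (t ∶ φ)  = □ t φ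

  record IsFullLPAlgebra : Set (c ⊔ v ⊔ p ⊔ s ⊔ a ⊔ ℓ) where
    field
      isPreLPAlgebra : IsPreLPAlgebra
      □-factive      : ∀ φ t (θ : Atom → Carrier) → □ t φ ≤ assign θ φ

record FullLPAlgebra {c v p s : Level} {L : Language c v p}
    (CS : ConstantSpecification L s) (a ℓ : Level)
    : Set (c ⊔ v ⊔ p ⊔ s ⊔ suc (a ⊔ ℓ)) where
  field
    booleanAlgebra  : BooleanAlgebra a ℓ
    □               : Tm L → Fm L → BooleanAlgebra.Carrier booleanAlgebra
    isFullLPAlgebra : IsFullLPAlgebra CS booleanAlgebra □

record Subalgebra {a ℓ : Level} (B : BooleanAlgebra a ℓ) (m : Level)
    : Set (a ⊔ ℓ ⊔ suc m) where
  open BooleanAlgebra B using (Carrier; _≈_; ⊥; ¬_; _∨_)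
  field
    member   : Pred Carrier m
    resp     : member Respects _≈_
    ⊥-closed : ⊥ ∈ member
    ¬-closed : ∀ {x} → x ∈ member → (¬ x) ∈ member
    ∨-closed : ∀ {x y} → x ∈ member → y ∈ member → (x ∨ y) ∈ member

module _ {a ℓ m : Level} {B : BooleanAlgebra a ℓ} (S : Subalgebra B m) where
  open BooleanAlgebra B
  open BooleanAlgebraProperties B using (deMorgan₁; ¬⊥≈⊤; ¬-involutive)
  open Subalgebra S

  private
    ⊤-closed : ⊤ ∈ member
    ⊤-closed = resp ¬⊥≈⊤ (¬-closed ⊥-closed)

    ∧-closed : ∀ {x y} → x ∈ member → y ∈ member → (x ∧ y) ∈ member
    ∧-closed {x} {y} x∈ y∈ =
      resp (trans (¬-cong (sym (deMorgan₁ x y))) (¬-involutive (x ∧ y)))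
           (¬-closed (∨-closed (¬-closed x∈) (¬-closed y∈)))

  subalgebra⇒booleanAlgebra : BooleanAlgebra (a ⊔ m) ℓ
  subalgebra⇒booleanAlgebra = record
    { Carrier = Σ Carrier member
    ; _≈_     = λ x y → proj₁ x ≈ proj₁ y
    ; _∨_     = λ x y → proj₁ x ∨ proj₁ y , ∨-closed (proj₂ x) (proj₂ y)
    ; _∧_     = λ x y → proj₁ x ∧ proj₁ y , ∧-closed (proj₂ x) (proj₂ y)
    ; ¬_      = λ x → ¬ proj₁ x , ¬-closed (proj₂ x)
    ; ⊤       = ⊤ , ⊤-closed
    ; ⊥       = ⊥ , ⊥-closed
    ; isBooleanAlgebra = record
      { isDistributiveLattice = record
        { isLattice = record
          { isEquivalence = record { refl = refl ; sym = sym ; trans = trans }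
          ; ∨-comm     = λ x y → ∨-comm (proj₁ x) (proj₁ y)
          ; ∨-assoc    = λ x y z → ∨-assoc (proj₁ x) (proj₁ y) (proj₁ z)
          ; ∨-cong     = ∨-cong
          ; ∧-comm     = λ x y → ∧-comm (proj₁ x) (proj₁ y)
          ; ∧-assoc    = λ x y z → ∧-assoc (proj₁ x) (proj₁ y) (proj₁ z)
          ; ∧-cong     = ∧-cong
          ; absorptive = (λ x y → ∨-absorbs-∧ (proj₁ x) (proj₁ y))
                       , (λ x y → ∧-absorbs-∨ (proj₁ x) (proj₁ y))
          }
        ; ∨-distrib-∧ = (λ x y z → ∨-distribˡ-∧ (proj₁ x) (proj₁ y) (proj₁ z))
                      , (λ x y z → ∨-distribʳ-∧ (proj₁ x) (proj₁ y) (proj₁ z))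
        ; ∧-distrib-∨ = (λ x y z → ∧-distribˡ-∨ (proj₁ x) (proj₁ y) (proj₁ z))
                      , (λ x y z → ∧-distribʳ-∨ (proj₁ x) (proj₁ y) (proj₁ z))
        }
      ; ∨-complement = (λ x → ∨-complementˡ (proj₁ x)) , (λ x → ∨-complementʳ (proj₁ x))
      ; ∧-complement = (λ x → ∧-complementˡ (proj₁ x)) , (λ x → ∧-complementʳ (proj₁ x))
      ; ¬-cong       = ¬-cong
      }
    }

-- Subsets are predicates up to mutual inclusion. Excluded middle is what makes
-- the relative complement ∁ a Boolean complement.
powerSet : ∀ {ℓ} → ExcludedMiddle ℓ → Set ℓ → BooleanAlgebra (suc ℓ) ℓ
powerSet {ℓ} em X = record
  { Carrier = Pred X ℓ
  ; _≈_     = _≐_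
  ; _∨_     = _∪_
  ; _∧_     = _∩_
  ; ¬_      = ∁
  ; ⊤       = U
  ; ⊥       = ∅
  ; isBooleanAlgebra = record
    { isDistributiveLattice = ∪-∩-isDistributiveLattice X ℓ
    ; ∨-complement = (λ P → _ , λ {x} _ → excludedˡ P x) , (λ P → _ , λ {x} _ → excludedʳ P x)
    ; ∧-complement = (λ P → (λ (x∉P , x∈P) → Empty.⊥-elim (x∉P x∈P)) , ⊥-elim)
                   , (λ P → (λ (x∈P , x∉P) → Empty.⊥-elim (x∉P x∈P)) , ⊥-elim)
    ; ¬-cong = λ (P⊆Q , Q⊆P) → (λ x∉P x∈Q → x∉P (Q⊆P x∈Q)) , (λ x∉Q x∈P → x∉Q (P⊆Q x∈P))
    }
  }
  where
  excludedˡ : (P : Pred X ℓ) → ∀ x → x ∈ ∁ P ∪ P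
  excludedˡ P x with em {P x}
  ... | yes x∈P = inj₂ x∈P
  ... | no  x∉P = inj₁ x∉P

  excludedʳ : (P : Pred X ℓ) → ∀ x → x ∈ P ∪ ∁ P
  excludedʳ P x with em {P x}
  ... | yes x∈P = inj₁ x∈P
  ... | no  x∉P = inj₂ x∉P

record FullLPSetAlgebra {ℓ c v p s : Level} (em : ExcludedMiddle ℓ) {L : Language c v p}
    (CS : ConstantSpecification L s) (m : Level)
    : Set (c ⊔ v ⊔ p ⊔ s ⊔ suc (ℓ ⊔ m)) where
  field
    X          : Set ℓ
    subalgebra : Subalgebra (powerSet em X) m

  setAlgebra : BooleanAlgebra (suc ℓ ⊔ m) ℓ
  setAlgebra = subalgebra⇒booleanAlgebra subalgebra

  field
    □               : Tm L → Fm L → BooleanAlgebra.Carrier setAlgebra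
    isFullLPAlgebra : IsFullLPAlgebra CS setAlgebra □

  fullLPAlgebra : FullLPAlgebra CS (suc ℓ ⊔ m) ℓ
  fullLPAlgebra = record
    { booleanAlgebra  = setAlgebra
    ; □               = □
    ; isFullLPAlgebra = isFullLPAlgebra
    }

record IsBooleanIsomorphism {a ℓ a′ ℓ′ : Level}
    (A : BooleanAlgebra a ℓ) (B : BooleanAlgebra a′ ℓ′)
    (f : BooleanAlgebra.Carrier A → BooleanAlgebra.Carrier B)
    : Set (a ⊔ ℓ ⊔ a′ ⊔ ℓ′) where
  private
    module A = BooleanAlgebra A
    module B = BooleanAlgebra B
  field
    cong       : Congruent A._≈_ B._≈_ f
    injective  : Injective A._≈_ B._≈_ f
    surjective : Surjective A._≈_ B._≈_ f
    ⊥-homo     : f A.⊥ B.≈ B.⊥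
    ¬-homo     : ∀ x → f (A.¬ x) B.≈ B.¬ f x
    ∨-homo     : ∀ x y → f (x A.∨ y) B.≈ (f x B.∨ f y)

infix 4 _≅_

record _≅_ {c v p s a ℓ a′ ℓ′ : Level} {L : Language c v p}
    {CS : ConstantSpecification L s}
    (𝓐 : FullLPAlgebra CS a ℓ) (𝓑 : FullLPAlgebra CS a′ ℓ′)
    : Set (c ⊔ v ⊔ p ⊔ a ⊔ ℓ ⊔ a′ ⊔ ℓ′) where
  private
    module 𝓐 = FullLPAlgebra 𝓐
    module 𝓑 = FullLPAlgebra 𝓑
    module B = BooleanAlgebra 𝓑.booleanAlgebra
  field
    to            : BooleanAlgebra.Carrier 𝓐.booleanAlgebra → B.Carrier
    isIsomorphism : IsBooleanIsomorphism 𝓐.booleanAlgebra 𝓑.booleanAlgebra to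
    □-homo        : ∀ t φ → to (𝓐.□ t φ) B.≈ 𝓑.□ t φ

{-# OPTIONS --safe #-}

-- Stone duality: x is sent to the set of ultrafilters containing x. This is an
-- embedding because distinct elements are separated by an ultrafilter, and the
-- operators □ₜ, which are mere functions on formulas, are carried along it.
-- Ultrafilters come from the Teichmüller–Tukey lemma, which is obtained by
-- iterating "add one more element" transfinitely: the stages generated by this
-- step and by unions form a chain, whose union is a maximal stage.
--
-- Subsets are Boolean-valued (no loss under excluded middle), so that the type
-- of subsets of A, and with it the type of ultrafilters, stays in the universe
-- of A.
module Submission where

open import Defs
open import Axiom.ExcludedMiddle using (ExcludedMiddle)
open import Axiom.Extensionality.Propositional using (Extensionality)
open import Algebra.Lattice.Bundles using (BooleanAlgebra)
import Algebra.Lattice.Properties.BooleanAlgebra as BooleanAlgebraProperties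
open import Data.Bool using (Bool; true; false; T)
open import Data.Empty using (⊥-elim)
open import Data.List using (List; []; _∷_; _++_; foldr)
open import Data.List.Relation.Unary.All using (All; []; _∷_)
import Data.List.Relation.Unary.All as All
open import Data.List.Relation.Unary.All.Properties using (++⁺)
open import Data.Product using (Σ-syntax; ∃-syntax; _×_; _,_; proj₁; proj₂)
open import Data.Sum using (_⊎_; inj₁; inj₂; [_,_]′)
open import Function using (_∘_; id; case_of_)
open import Level using (Level; _⊔_; Lift; lift; lower)
import Relation.Binary.Lattice as OrderTheoretic
open import Relation.Binary.PropositionalEquality as ≡ using (_≡_)
import Relation.Binary.Reasoning.Setoid as SetoidReasoning
open import Relation.Nullary using (¬_; yes; no; isYes; toWitness; fromWitness; decidable-stable)
open import Relation.Unary using (Pred; _≐_)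

-- Classical reasoning and Boolean-valued subsets.

module _ (em : ∀ {ℓ} → ExcludedMiddle ℓ) where

  truth : ∀ {ℓ} → Set ℓ → Bool
  truth P = isYes (em {P = P})

  by-contradiction : ∀ {ℓ} {P : Set ℓ} → ¬ ¬ P → P
  by-contradiction = decidable-stable em

  ¬∀⇒∃¬ : ∀ {a b} {A : Set a} {B : A → Set b} → ¬ (∀ x → B x) → ∃[ x ] ¬ B x
  ¬∀⇒∃¬ ¬∀ = by-contradiction λ ¬∃ → ¬∀ λ x → by-contradiction λ ¬Bx → ¬∃ (x , ¬Bx)

Subset : ∀ {a} → Set a → Set a
Subset A = A → Bool

infix 4 _⊑_

_⊑_ : ∀ {a} {A : Set a} → Subset A → Subset A → Set a
S ⊑ S′ = ∀ {x} → T (S x) → T (S′ x)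

⊑-antisym : ∀ {a} → Extensionality a Level.zero → {A : Set a} {S S′ : Subset A} →
            S ⊑ S′ → S′ ⊑ S → S ≡ S′
⊑-antisym funext S⊑S′ S′⊑S = funext λ x → T-injective S⊑S′ S′⊑S
  where
  T-injective : ∀ {b c} → (T b → T c) → (T c → T b) → b ≡ c
  T-injective {true}  {true}  f g = ≡.refl
  T-injective {true}  {false} f g = ⊥-elim (f _)
  T-injective {false} {true}  f g = ⊥-elim (g _)
  T-injective {false} {false} f g = ≡.refl

module _ (em : ∀ {ℓ} → ExcludedMiddle ℓ) {a} {A : Set a} where

  ⋃ : Subset (Subset A) → Subset A
  ⋃ P x = truth em (∃[ S ] T (P S) × T (S x))

  ∈-⋃ : ∀ {P S} → T (P S) → S ⊑ ⋃ P
  ∈-⋃ {S = S} S∈P x∈S = fromWitness (S , S∈P , x∈S)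

  ⋃-least : ∀ {P S} → (∀ {S′} → T (P S′) → S′ ⊑ S) → ⋃ P ⊑ S
  ⋃-least P⊑S x∈⋃P with toWitness x∈⋃P
  ... | S′ , S′∈P , x∈S′ = P⊑S S′∈P x∈S′

  insert : A → Subset A → Subset A
  insert y S x = truth em (T (S x) ⊎ x ≡ y)

  ∈-insert : ∀ {y} (S : Subset A) → T (insert y S y)
  ∈-insert S = fromWitness (inj₂ ≡.refl)

  ⊑-insert : ∀ {y} (S : Subset A) → S ⊑ insert y S
  ⊑-insert S x∈S = fromWitness (inj₁ x∈S)

-- Transfinite iteration of an inflationary map.

module Tower (em : ∀ {ℓ} → ExcludedMiddle ℓ) (funext : ∀ {a b} → Extensionality a b)
             {a} {A : Set a} (f : Subset A → Subset A) (f-inflationary : ∀ S → S ⊑ f S) where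

  -- An empty `P` in `limit` yields the empty subset, from which the iteration starts.
  data Stage : Subset A → Set a where
    step  : ∀ {S} → Stage S → Stage (f S)
    limit : ∀ P → (∀ {S} → T (P S) → Stage S) → Stage (⋃ em P)

  -- Since `f` need not be monotone, both inclusions are used: extensionality turns them into an
  -- equality.
  f-⊑ : ∀ {S S′} → S ⊑ S′ → S′ ⊑ S → f S ⊑ f S′
  f-⊑ {S} {S′} S⊑S′ S′⊑S with ⊑-antisym funext {S = S} {S′} S⊑S′ S′⊑S
  ... | ≡.refl = id

  -- Bourbaki's extreme points, as in the proof of the Bourbaki–Witt theorem.
  Extreme : Subset A → Set a
  Extreme S = ∀ {S′} → Stage S′ → S′ ⊑ S → S ⊑ S′ ⊎ f S′ ⊑ S

  -- Induction on `S′`. If `S′ ⊑ S`, extremality gives `f S′ ⊑ S` unless the two coincide; a union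
  -- contains `f S` once a member does, and otherwise lies inside `S`.
  extreme-comparable : ∀ {S} → Extreme S → ∀ {S′} → Stage S′ → S′ ⊑ S ⊎ f S ⊑ S′
  extreme-comparable {S} extreme (step {S′} s′) with extreme-comparable extreme s′
  ... | inj₂ fS⊑S′ = inj₂ (f-inflationary S′ ∘ fS⊑S′)
  ... | inj₁ S′⊑S with extreme s′ S′⊑S
  ...   | inj₁ S⊑S′  = inj₂ (f-⊑ S⊑S′ S′⊑S)
  ...   | inj₂ fS′⊑S = inj₁ fS′⊑S
  extreme-comparable {S} extreme (limit P stages)
    with em {P = ∃[ S′ ] T (P S′) × f S ⊑ S′}
  ... | yes (S′ , S′∈P , fS⊑S′) = inj₂ (∈-⋃ em S′∈P ∘ fS⊑S′)
  ... | no none = inj₁ (⋃-least em λ {S′} S′∈P →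
    case extreme-comparable extreme (stages S′∈P) of λ where
      (inj₁ S′⊑S)  → S′⊑S
      (inj₂ fS⊑S′) → ⊥-elim (none (S′ , S′∈P , λ {x} → fS⊑S′ {x})))

  stage-extreme : ∀ {S} → Stage S → Extreme S
  stage-extreme (step {S} s) {S′} s′ S′⊑fS with extreme-comparable (stage-extreme s) s′
  ... | inj₂ fS⊑S′ = inj₁ fS⊑S′
  ... | inj₁ S′⊑S with stage-extreme s s′ S′⊑S
  ...   | inj₁ S⊑S′  = inj₂ (f-⊑ S′⊑S S⊑S′)
  ...   | inj₂ fS′⊑S = inj₂ (f-inflationary S ∘ fS′⊑S)
  stage-extreme (limit P stages) {S′} s′ S′⊑⋃P
    with em {P = ∃[ S ] T (P S) × ¬ (f S ⊑ S′)}
  ... | no none = inj₁ (⋃-least em λ {S} S∈P {x} x∈S →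
    by-contradiction em λ x∉S′ → none (S , S∈P , λ fS⊑S′ → x∉S′ (fS⊑S′ (f-inflationary S x∈S))))
  ... | yes (S , S∈P , fS⋢S′) with extreme-comparable (stage-extreme (stages S∈P)) s′
  ...   | inj₂ fS⊑S′ = ⊥-elim (fS⋢S′ fS⊑S′)
  ...   | inj₁ S′⊑S with stage-extreme (stages S∈P) s′ S′⊑S
  ...     | inj₂ fS′⊑S = inj₂ (∈-⋃ em S∈P ∘ fS′⊑S)
  -- Now `S` and `S′` coincide, so comparing `S` with the union itself decides.
  ...     | inj₁ S⊑S′
    with extreme-comparable (stage-extreme (stages S∈P)) (limit P stages)
  ...       | inj₁ ⋃P⊑S  = inj₁ (S⊑S′ ∘ ⋃P⊑S)
  ...       | inj₂ fS⊑⋃P = inj₂ (fS⊑⋃P ∘ f-⊑ S′⊑S S⊑S′)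

  stages-total : ∀ {S S′} → Stage S → Stage S′ → S ⊑ S′ ⊎ S′ ⊑ S
  stages-total {S} {S′} s s′ with extreme-comparable (stage-extreme s) s′
  ... | inj₁ S′⊑S  = inj₂ S′⊑S
  ... | inj₂ fS⊑S′ = inj₁ (fS⊑S′ ∘ f-inflationary S)

  largest : Subset A
  largest = ⋃ em (λ S → truth em (Stage S))

  largest-stage : Stage largest
  largest-stage = limit _ toWitness

  -- `limit` applies to the set of all stages, so their union is a stage; its image under `f` is
  -- then one of the sets united.
  f-largest : f largest ⊑ largest
  f-largest = ∈-⋃ em (fromWitness (step largest-stage))

-- The Teichmüller-Tukey lemma.

module Tukey (em : ∀ {ℓ} → ExcludedMiddle ℓ) (funext : ∀ {a b} → Extensionality a b)
             {a c} {A : Set a} (C : List A → Set c) where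

  Consistent : Subset A → Set (a ⊔ c)
  Consistent S = ∀ l → All (T ∘ S) l → C l

  Extension : Subset A → Set (a ⊔ c)
  Extension S = ∃[ y ] ¬ T (S y) × Consistent (insert em y S)

  -- Excluded middle for the Σ-type `Extension S` returns an actual witness, so it also chooses the
  -- new element.
  extend : Subset A → Subset A
  extend S with em {P = Extension S}
  ... | yes (y , _) = insert em y S
  ... | no  _       = S

  extend-inflationary : ∀ S → S ⊑ extend S
  extend-inflationary S with em {P = Extension S}
  ... | yes _ = ⊑-insert em S
  ... | no  _ = id

  extend-consistent : ∀ {S} → Consistent S → Consistent (extend S)
  extend-consistent {S} consistent with em {P = Extension S}
  ... | yes (_ , _ , consistent′) = consistent′
  ... | no  _                     = consistent

  extend-⊑⇒¬Extension : ∀ {S} → extend S ⊑ S → ¬ Extension S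
  extend-⊑⇒¬Extension {S} extend⊑ extension with em {P = Extension S}
  ... | yes (y , y∉S , _) = y∉S (extend⊑ (∈-insert em S))
  ... | no  none          = none extension

  open Tower em funext extend extend-inflationary

  -- Stages form a chain, so of the finitely many members that contain the listed elements one is
  -- largest. The list is nonempty because `P` may be empty; the empty list is left to `C []`.
  finite⊆member : ∀ P → (∀ {S} → T (P S) → Stage S) → ∀ y l → All (T ∘ ⋃ em P) (y ∷ l) →
                  ∃[ S ] T (P S) × All (T ∘ S) (y ∷ l)
  finite⊆member P stages y [] (y∈ ∷ []) with toWitness y∈
  ... | S , S∈P , y∈S = S , S∈P , y∈S ∷ []
  finite⊆member P stages y (z ∷ l) (y∈ ∷ zl⊆)
    with toWitness y∈ | finite⊆member P stages z l zl⊆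
  ... | S , S∈P , y∈S | S′ , S′∈P , zl⊆S′ with stages-total (stages S∈P) (stages S′∈P)
  ...   | inj₁ S⊑S′ = S′ , S′∈P , S⊑S′ y∈S ∷ zl⊆S′
  ...   | inj₂ S′⊑S = S  , S∈P  , y∈S ∷ All.map S′⊑S zl⊆S′

  stage-consistent : C [] → ∀ {S} → Stage S → Consistent S
  stage-consistent C[] (step s) = extend-consistent (stage-consistent C[] s)
  stage-consistent C[] (limit P stages) []      _ = C[]
  stage-consistent C[] (limit P stages) (y ∷ l) yl⊆⋃P
    with finite⊆member P stages y l yl⊆⋃P
  ... | S , S∈P , yl⊆S = stage-consistent C[] (stages S∈P) (y ∷ l) yl⊆S

  -- A `y` outside `largest` that could be added consistently would contradict `extend` not
  -- enlarging `largest`.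
  tukey : C [] → ∃[ M ] Consistent M × (∀ y → Consistent (insert em y M) → T (M y))
  tukey C[] = largest , stage-consistent C[] largest-stage , λ y consistent →
    by-contradiction em λ y∉M → extend-⊑⇒¬Extension f-largest (y , y∉M , consistent)

-- Ultrafilters and their existence.

module _ {a ℓ} (B : BooleanAlgebra a ℓ) where
  open BooleanAlgebra B renaming (¬_ to ⊖_)

  -- The clauses speak of complement and join, the operations `stone` has to preserve; closure under
  -- meets follows by De Morgan.
  record Ultrafilter : Set (a ⊔ ℓ) where
    field
      member : Subset Carrier
      resp   : ∀ {x y} → x ≈ y → T (member x) → T (member y)
      ⊥∉     : ¬ T (member ⊥)
      ⊖⇒∉    : ∀ {x} → T (member (⊖ x)) → ¬ T (member x)
      ∉⇒⊖    : ∀ {x} → ¬ T (member x) → T (member (⊖ x))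
      ∨-prime : ∀ {x y} → T (member (x ∨ y)) → T (member x) ⊎ T (member y)
      ∨-introˡ : ∀ {x} y → T (member x) → T (member (x ∨ y))
      ∨-introʳ : ∀ x {y} → T (member y) → T (member (x ∨ y))

module _ (em : ∀ {ℓ} → ExcludedMiddle ℓ) (funext : ∀ {a b} → Extensionality a b)
         {a ℓ} (B : BooleanAlgebra a ℓ) where
  open BooleanAlgebra B renaming (¬_ to ⊖_)
  open BooleanAlgebraProperties B
    using (∨-∧-orderTheoreticLattice; ∧-zeroˡ; ∧-identityʳ)
  open OrderTheoretic.Lattice ∨-∧-orderTheoreticLattice
    using (_≤_; x≤x∨y; y≤x∨y; ∨-least; x∧y≤x; x∧y≤y; ∧-greatest; antisym)
    renaming (reflexive to ≤-reflexive; trans to ≤-trans; refl to ≤-refl)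

  ⊥≤ : ∀ x → ⊥ ≤ x
  ⊥≤ x = sym (∧-zeroˡ x)

  ≤-split : ∀ {x y z} → x ∧ y ≤ z → x ∧ ⊖ y ≤ z → x ≤ z
  ≤-split {x} {y} {z} xy≤z x⊖y≤z = ≤-trans (≤-reflexive x≈) (∨-least xy≤z x⊖y≤z)
    where
    open SetoidReasoning setoid
    x≈ : x ≈ (x ∧ y) ∨ (x ∧ ⊖ y)
    x≈ = begin
      x                     ≈⟨ ∧-identityʳ x ⟨
      x ∧ ⊤                 ≈⟨ ∧-cong refl (∨-complementʳ y) ⟨
      x ∧ (y ∨ ⊖ y)         ≈⟨ ∧-distribˡ-∨ x y (⊖ y) ⟩
      (x ∧ y) ∨ (x ∧ ⊖ y)   ∎

  ≤-complement : ∀ {x y} → x ≤ y → x ≤ ⊖ y → x ≤ ⊥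
  ≤-complement {y = y} x≤y x≤⊖y =
    ≤-trans (∧-greatest x≤y x≤⊖y) (≤-reflexive (∧-complementʳ y))

  module _ (x₀ : Carrier) where

    -- Seeding the fold with `x₀` builds `x₀` into the generated filter: `Proper []` says that `x₀`
    -- is nonzero.
    ⋀ : List Carrier → Carrier
    ⋀ = foldr _∧_ x₀

    ⋀-++ˡ : ∀ l l′ → ⋀ (l ++ l′) ≤ ⋀ l
    ⋀-++ˡ []      []       = ≤-refl
    ⋀-++ˡ []      (y ∷ l′) = ≤-trans (x∧y≤y y _) (⋀-++ˡ [] l′)
    ⋀-++ˡ (y ∷ l) l′       =
      ∧-greatest (x∧y≤x y _) (≤-trans (x∧y≤y y _) (⋀-++ˡ l l′))

    ⋀-++ʳ : ∀ l l′ → ⋀ (l ++ l′) ≤ ⋀ l′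
    ⋀-++ʳ []      l′ = ≤-refl
    ⋀-++ʳ (y ∷ l) l′ = ≤-trans (x∧y≤y y _) (⋀-++ʳ l l′)

    Proper : List Carrier → Set ℓ
    Proper l = ¬ (⋀ l ≤ ⊥)

    open Tukey em funext Proper

    -- All occurrences of `y` in `l` are removed and replaced by a single meet with `y`.
    drop-inserted : ∀ {M y} l → All (T ∘ insert em y M) l →
                    ∃[ l′ ] All (T ∘ M) l′ × ⋀ l′ ∧ y ≤ ⋀ l
    drop-inserted []      []        = [] , [] , x∧y≤x _ _
    drop-inserted (z ∷ l) (z∈ ∷ l⊆) with toWitness z∈ | drop-inserted l l⊆
    ... | inj₂ ≡.refl | l′ , l′⊆M , l′≤ = l′ , l′⊆M , ∧-greatest (x∧y≤y _ _) l′≤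
    ... | inj₁ z∈M    | l′ , l′⊆M , l′≤ = z ∷ l′ , z∈M ∷ l′⊆M ,
      ∧-greatest (≤-trans (x∧y≤x _ _) (x∧y≤x z _))
                 (≤-trans (∧-greatest (≤-trans (x∧y≤x _ _) (x∧y≤y z _)) (x∧y≤y _ _)) l′≤)

    module _ {M : Subset Carrier} (consistent : Consistent M)
             (maximal : ∀ y → Consistent (insert em y M) → T (M y)) where

      -- By maximality, adding `y` is inconsistent; stripping `y` from an offending list leaves
      -- elements of `M` whose meet is disjoint from `y`.
      refuted : ∀ {y} → ¬ T (M y) → ∃[ l ] All (T ∘ M) l × ⋀ l ∧ y ≤ ⊥
      refuted {y} y∉M with ¬∀⇒∃¬ em (y∉M ∘ maximal y)
      ... | l , ¬proper =
        let l⊆ , l≤⊥ = by-contradiction em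
              λ ¬both → ¬proper λ l⊆ l≤⊥ → ¬both (l⊆ , l≤⊥)
            l′ , l′⊆M , l′≤l = drop-inserted l l⊆
        in l′ , l′⊆M , ≤-trans l′≤l l≤⊥

      -- If `y` and `⊖ y` were both outside `M`, joining their refuting lists would give a meet
      -- disjoint from both, hence zero.
      complement-∈ : ∀ {y} → ¬ T (M y) → T (M (⊖ y))
      complement-∈ {y} y∉M = by-contradiction em λ ⊖y∉M →
        let l , l⊆M , ly≤⊥    = refuted y∉M
            l′ , l′⊆M , l′y≤⊥ = refuted ⊖y∉M
        in consistent (l ++ l′) (++⁺ l⊆M l′⊆M) (≤-split
             (≤-trans (∧-greatest (≤-trans (x∧y≤x _ y) (⋀-++ˡ l l′)) (x∧y≤y _ y)) ly≤⊥)
             (≤-trans (∧-greatest (≤-trans (x∧y≤x _ (⊖ y)) (⋀-++ʳ l l′)) (x∧y≤y _ (⊖ y)))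
                      l′y≤⊥))

      -- Otherwise `⊖ y` is in `M`, and prepending it to `l` makes the meet zero.
      closed : ∀ l → All (T ∘ M) l → ∀ {y} → ⋀ l ≤ y → T (M y)
      closed l l⊆M {y} l≤y = by-contradiction em λ y∉M →
        consistent (⊖ y ∷ l) (complement-∈ y∉M ∷ l⊆M)
          (≤-complement (≤-trans (x∧y≤y _ _) l≤y) (x∧y≤x _ _))

      upward : ∀ {x y} → x ≤ y → T (M x) → T (M y)
      upward {x} x≤y x∈M = closed (x ∷ []) (x∈M ∷ []) (≤-trans (x∧y≤x _ _) x≤y)

      complement-∉ : ∀ {y} → T (M (⊖ y)) → ¬ T (M y)
      complement-∉ {y} ⊖y∈M y∈M = consistent (⊖ y ∷ y ∷ []) (⊖y∈M ∷ y∈M ∷ [])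
        (≤-complement (≤-trans (x∧y≤y _ _) (x∧y≤x _ _)) (x∧y≤x _ _))

      prime : ∀ {x y} → T (M (x ∨ y)) → T (M x) ⊎ T (M y)
      prime {x} {y} x∨y∈M with em {P = T (M x)}
      ... | yes x∈M = inj₁ x∈M
      ... | no  x∉M = inj₂ (closed (⊖ x ∷ x ∨ y ∷ []) (complement-∈ x∉M ∷ x∨y∈M ∷ [])
          (≤-trans (∧-greatest (x∧y≤x _ _) (≤-trans (x∧y≤y _ _) (x∧y≤x _ _))) modus))
        where
        modus : ⊖ x ∧ (x ∨ y) ≤ y
        modus = ≤-trans (≤-reflexive (∧-distribˡ-∨ (⊖ x) x y))
          (∨-least (≤-trans (≤-reflexive (∧-complementˡ x)) (⊥≤ y)) (x∧y≤y _ _))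

      maximal⇒ultrafilter : Ultrafilter B
      maximal⇒ultrafilter = record
        { member   = M
        ; resp     = upward ∘ ≤-reflexive
        ; ⊥∉       = λ ⊥∈M → consistent (⊥ ∷ []) (⊥∈M ∷ []) (x∧y≤x _ _)
        ; ⊖⇒∉      = complement-∉
        ; ∉⇒⊖      = complement-∈
        ; ∨-prime  = prime
        ; ∨-introˡ = λ y → upward (x≤x∨y _ y)
        ; ∨-introʳ = λ x → upward (y≤x∨y x _)
        }

    ultrafilter-above : ¬ (x₀ ≤ ⊥) →
                        Σ[ u ∈ Ultrafilter B ] (∀ {y} → x₀ ≤ y → T (Ultrafilter.member u y))
    ultrafilter-above x₀≰⊥ with tukey x₀≰⊥
    ... | M , consistent , maximal =
      -- The empty list has meet `x₀`, so `closed` covers everything above `x₀`.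
      maximal⇒ultrafilter consistent maximal , closed consistent maximal [] []

  -- If `x ∧ ⊖ y` is nonzero, an ultrafilter above it contains `x` and omits `y`.
  separation : ∀ {x y} → (∀ (u : Ultrafilter B) → let open Ultrafilter u in
                          T (member x) → T (member y)) → x ≤ y
  separation {x} {y} x⊑y with em {P = x ∧ ⊖ y ≤ ⊥}
  ... | yes x⊖y≤⊥ = ≤-split (x∧y≤y x y) (≤-trans x⊖y≤⊥ (⊥≤ y))
  ... | no  x⊖y≰⊥ =
    let u , above = ultrafilter-above (x ∧ ⊖ y) x⊖y≰⊥
    in ⊥-elim (Ultrafilter.⊖⇒∉ u (above (x∧y≤y _ _)) (x⊑y u (above (x∧y≤x _ _))))

  -- The Stone embedding.

  stone : Carrier → Pred (Ultrafilter B) (a ⊔ ℓ)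
  -- `powerSet` takes predicates at the level of the underlying set, hence the `Lift`.
  stone x u = Lift (a ⊔ ℓ) (T (Ultrafilter.member u x))

  stone-cong : ∀ {x y} → x ≈ y → stone x ≐ stone y
  stone-cong x≈y = (λ {u} (lift x∈u) → lift (Ultrafilter.resp u x≈y x∈u))
                 , (λ {u} (lift y∈u) → lift (Ultrafilter.resp u (sym x≈y) y∈u))

  stone-injective : ∀ {x y} → stone x ≐ stone y → x ≈ y
  stone-injective (x⊆y , y⊆x) =
    antisym (separation λ u x∈u → lower (x⊆y {u} (lift x∈u)))
            (separation λ u y∈u → lower (y⊆x {u} (lift y∈u)))

  private module 𝒫 = BooleanAlgebra (powerSet (em {a ⊔ ℓ}) (Ultrafilter B))

  stone-⊥ : stone ⊥ 𝒫.≈ 𝒫.⊥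
  stone-⊥ = (λ {u} (lift ⊥∈u) → ⊥-elim (Ultrafilter.⊥∉ u ⊥∈u)) , λ ()

  stone-⊖ : ∀ x → stone (⊖ x) 𝒫.≈ 𝒫.¬ stone x
  stone-⊖ x = (λ {u} (lift ⊖x∈u) (lift x∈u) → Ultrafilter.⊖⇒∉ u ⊖x∈u x∈u)
            , (λ {u} x∉u → lift (Ultrafilter.∉⇒⊖ u (x∉u ∘ lift)))

  stone-∨ : ∀ x y → stone (x ∨ y) 𝒫.≈ (stone x 𝒫.∨ stone y)
  stone-∨ x y = (λ {u} (lift xy∈u) → [ inj₁ ∘ lift , inj₂ ∘ lift ]′ (Ultrafilter.∨-prime u xy∈u))
              , (λ {u} → [ (λ (lift x∈u) → lift (Ultrafilter.∨-introˡ u y x∈u))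
                         , (λ (lift y∈u) → lift (Ultrafilter.∨-introʳ u x y∈u)) ]′)

  -- The image of `stone`, with the preimage kept as data for surjectivity to read off.
  stoneAlgebra : Subalgebra (powerSet (em {a ⊔ ℓ}) (Ultrafilter B)) (a ⊔ ℓ)
  stoneAlgebra = record
    { member   = λ P → ∃[ x ] stone x 𝒫.≈ P
    ; resp     = λ P≈Q (x , x≈P) → x , 𝒫.trans x≈P P≈Q
    ; ⊥-closed = ⊥ , stone-⊥
    ; ¬-closed = λ (x , x≈P) → ⊖ x , 𝒫.trans (stone-⊖ x) (𝒫.¬-cong x≈P)
    ; ∨-closed = λ (x , x≈P) (y , y≈Q) → x ∨ y , 𝒫.trans (stone-∨ x y) (𝒫.∨-cong x≈P y≈Q)
    }

  toStone : Carrier → BooleanAlgebra.Carrier (subalgebra⇒booleanAlgebra stoneAlgebra)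
  toStone x = stone x , x , 𝒫.refl

  toStone-isIsomorphism :
    IsBooleanIsomorphism B (subalgebra⇒booleanAlgebra stoneAlgebra) toStone
  toStone-isIsomorphism = record
    { cong       = stone-cong
    ; injective  = stone-injective
    ; surjective = λ (P , x , x≈P) → x , λ z≈x → 𝒫.trans (stone-cong z≈x) x≈P
    ; ⊥-homo     = stone-⊥
    ; ¬-homo     = stone-⊖
    ; ∨-homo     = stone-∨
    }

-- Transport of the boxes along a Boolean isomorphism.

module Transport {a ℓ a′ ℓ′} {A : BooleanAlgebra a ℓ} {B : BooleanAlgebra a′ ℓ′}
                 {f : BooleanAlgebra.Carrier A → BooleanAlgebra.Carrier B}
                 (iso : IsBooleanIsomorphism A B f) where
  private
    module A = BooleanAlgebra A
    module B = BooleanAlgebra B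
    module DA = Derived A
    module DB = Derived B
  open IsBooleanIsomorphism iso

  𝟙-homo : f DA.𝟙 B.≈ DB.𝟙
  𝟙-homo = B.trans (¬-homo A.⊥) (B.¬-cong ⊥-homo)

  ⊗-homo : ∀ x y → f (x DA.⊗ y) B.≈ (f x DB.⊗ f y)
  ⊗-homo x y = B.trans (¬-homo _) (B.¬-cong
    (B.trans (∨-homo _ _) (B.∨-cong (¬-homo x) (¬-homo y))))

  ⇒-homo : ∀ x y → f (x DA.⇒ y) B.≈ (f x DB.⇒ f y)
  ⇒-homo x y = B.trans (∨-homo _ _) (B.∨-cong (¬-homo x) B.refl)

  ≤-mono : ∀ {x y} → x DA.≤ y → f x DB.≤ f y
  ≤-mono x≤y = B.trans (B.sym (⇒-homo _ _)) (B.trans (cong x≤y) 𝟙-homo)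

  ≤-resp : ∀ {x x′ y y′} → x B.≈ x′ → y B.≈ y′ → x DB.≤ y → x′ DB.≤ y′
  ≤-resp x≈x′ y≈y′ = B.trans (B.sym (B.∨-cong (B.¬-cong x≈x′) y≈y′))

  module _ {c v p s} {L : Language c v p} (CS : ConstantSpecification L s)
           {□ : Tm L → Fm L → A.Carrier} where
    open Language L using (Atom)

    assign-homo : (θ : Atom → A.Carrier) (θ′ : Atom → B.Carrier) →
                  (∀ q → f (θ q) B.≈ θ′ q) →
                  ∀ φ → f (assign CS A □ θ φ) B.≈ assign CS B (λ t φ → f (□ t φ)) θ′ φ
    assign-homo θ θ′ θ≈θ′ (atom q) = θ≈θ′ q
    assign-homo θ θ′ θ≈θ′ ⊥ᶠ       = ⊥-homo
    assign-homo θ θ′ θ≈θ′ (¬ᶠ φ)   =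
      B.trans (¬-homo _) (B.¬-cong (assign-homo θ θ′ θ≈θ′ φ))
    assign-homo θ θ′ θ≈θ′ (φ ∨ᶠ ψ) = B.trans (∨-homo _ _)
      (B.∨-cong (assign-homo θ θ′ θ≈θ′ φ) (assign-homo θ θ′ θ≈θ′ ψ))
    -- The valuation has no influence here, and the box on `B` is by definition the image of `□`.
    assign-homo θ θ′ θ≈θ′ (t ∶ φ)  = B.refl

    isFullLPAlgebra : IsFullLPAlgebra CS A □ → IsFullLPAlgebra CS B (λ t φ → f (□ t φ))
    isFullLPAlgebra full = record
      { isPreLPAlgebra = record
        { □-app   = λ s t φ ψ → ≤-resp (⊗-homo _ _) B.refl (≤-mono (□-app s t φ ψ))
        ; □-sum   = λ s t φ → ≤-resp (∨-homo _ _) B.refl (≤-mono (□-sum s t φ))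
        ; □-check = λ t φ → ≤-mono (□-check t φ)
        ; □-const = λ k φ k∶φ∈CS → B.trans (cong (□-const k φ k∶φ∈CS)) 𝟙-homo
        }
      -- Factivity ranges over all valuations in `B`; surjectivity pulls each one back to `A`.
      ; □-factive = λ φ t θ′ →
          ≤-resp B.refl (assign-homo (preimage θ′) θ′ (f-preimage θ′) φ)
            (≤-mono (□-factive φ t (preimage θ′)))
      }
      where
      open IsFullLPAlgebra full
      open IsPreLPAlgebra isPreLPAlgebra

      preimage : (Atom → B.Carrier) → Atom → A.Carrier
      preimage θ′ q = proj₁ (surjective (θ′ q))

      f-preimage : ∀ θ′ q → f (preimage θ′ q) B.≈ θ′ q
      f-preimage θ′ q = proj₂ (surjective (θ′ q)) A.refl

theorem4p11 : (em : ∀ {ℓ} → ExcludedMiddle ℓ) →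
    (funext : ∀ {a b} → Extensionality a b) →
    ∀ {c v p s a ℓ : Level} {L : Language c v p}
    (CS : ConstantSpecification L s) (𝓐 : FullLPAlgebra CS a ℓ) →
    Σ[ 𝓑 ∈ FullLPSetAlgebra (em {a ⊔ ℓ}) CS (a ⊔ ℓ) ]
    (𝓐 ≅ FullLPSetAlgebra.fullLPAlgebra 𝓑)
theorem4p11 em funext CS 𝓐 =
  record
    { X               = Ultrafilter booleanAlgebra
    ; subalgebra      = stoneAlgebra em funext booleanAlgebra
    ; □               = λ t φ → toStone em funext booleanAlgebra (□ t φ)
    ; isFullLPAlgebra = Transport.isFullLPAlgebra isomorphism CS isFullLPAlgebra
    }
  , record
    { to            = toStone em funext booleanAlgebra
    ; isIsomorphism = isomorphism
    ; □-homo        = λ t φ → id , id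
    }
  where
  open FullLPAlgebra 𝓐
  isomorphism = toStone-isIsomorphism em funext booleanAlgebra
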